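{- Let $a,b,c$ be positive integers and let $Q_{a,b,c}$ be the quiver with vertices $1,2,3$, with $a$ arrows $1\to2$, $b$ arrows $2\to3$ and $c$ arrows $3\to1$. If at least one of $a,b,c$ equals $1$, then $Q_{a,b,c}$ has a maximal green sequence.
   Context: A quiver is a finite directed multigraph with no loops and no oriented 2-cycles. Mutation $\mu_k$: for every path $i\to k\to j$ add an arrow $i\to j$, reverse all arrows at $k$, delete a maximal collection of oriented 2-cycles (and arrows between frozen vertices). The framed quiver $\hat Q$ adds a frozen (never mutated) vertex $i'$ and an arrow $i\to i'$ for each vertex $i$. A non-frozen vertex is green if it has no incoming arrow from a frozen vertex and red if it has no outgoing arrow to a frozen vertex. $(i_1,\dots,i_l)$ is a maximal green sequence if each $i_t$ is green in $\mu_{i_{t-1}}\cdots\mu_{i_1}(\hat Q)$ and every non-frozen vertex of $\mu_{i_l}\cdots\mu_{i_1}(\hat Q)$ is red. -}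

module Defs where

open import Data.Nat using (ℕ; zero; suc; _+_; _*_; _∸_)
open import Data.Fin using (Fin; zero; suc)
open import Data.Fin.Properties using () renaming (_≟_ to _≟F_)
open import Data.Sum using (_⊎_; inj₁; inj₂)
open import Data.List using (List; []; _∷_)
open import Data.Product using (_×_; ∃)
open import Data.Unit using (⊤)
open import Relation.Nullary using (yes; no; ¬_)
open import Relation.Binary.PropositionalEquality using (_≡_)

-- A quiver on a vertex set V is given by its arrow counts:
-- Q i j = number of arrows i → j.
Quiver : Set → Set
Quiver V = V → V → ℕ

IsQuiver : {V : Set} → Quiver V → Set
IsQuiver {V} Q = ((i : V) → Q i i ≡ 0) × ((i j : V) → Q i j ≡ 0 ⊎ Q j i ≡ 0)

-- Vertices of a framed quiver on n mutable vertices: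
-- inj₁ i = non-frozen vertex i, inj₂ i = frozen vertex i'.
FVert : ℕ → Set
FVert n = Fin n ⊎ Fin n

frame : {n : ℕ} → Quiver (Fin n) → Quiver (FVert n)
frame Q (inj₁ i) (inj₁ j) = Q i j
frame Q (inj₁ i) (inj₂ j) with i ≟F j
... | yes _ = 1
... | no  _ = 0
frame Q (inj₂ i) _ = 0

-- Mutation at a non-frozen vertex k.
--  * arrows incident to k are reversed;
--  * for i, j ≠ k: after adding Q i k * Q k j arrows i → j (for each path
--    i → k → j), a maximal collection of oriented 2-cycles is removed, which
--    leaves (p ∸ q) arrows i → j where p, q are the counts i→j, j→i;
--  * arrows between two frozen vertices are deleted.
mutate : {n : ℕ} → Fin n → Quiver (FVert n) → Quiver (FVert n)
mutate {n} k Q i j = go i j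
  where
    other : FVert n → FVert n → ℕ
    other i j = (Q i j + Q i (inj₁ k) * Q (inj₁ k) j)
              ∸ (Q j i + Q j (inj₁ k) * Q (inj₁ k) i)
    go : FVert n → FVert n → ℕ
    go (inj₂ _) (inj₂ _) = 0
    go (inj₁ i) j with i ≟F k
    ... | yes _ = Q j (inj₁ i)
    ... | no  _ with j
    ...   | inj₁ j' with j' ≟F k
    ...     | yes _ = Q (inj₁ j') (inj₁ i)
    ...     | no  _ = other (inj₁ i) (inj₁ j')
    go (inj₁ i) j | no _ | inj₂ j' = other (inj₁ i) (inj₂ j')
    go (inj₂ i) (inj₁ j) with j ≟F k
    ... | yes _ = Q (inj₁ j) (inj₂ i)
    ... | no  _ = other (inj₂ i) (inj₁ j)

mutateSeq : {n : ℕ} → List (Fin n) → Quiver (FVert n) → Quiver (FVert n)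
mutateSeq []       Q = Q
mutateSeq (k ∷ ks) Q = mutateSeq ks (mutate k Q)

Green : {n : ℕ} → Quiver (FVert n) → Fin n → Set
Green {n} Q i = (j : Fin n) → Q (inj₂ j) (inj₁ i) ≡ 0

Red : {n : ℕ} → Quiver (FVert n) → Fin n → Set
Red {n} Q i = (j : Fin n) → Q (inj₁ i) (inj₂ j) ≡ 0

AllGreenSteps : {n : ℕ} → Quiver (FVert n) → List (Fin n) → Set
AllGreenSteps Q []       = ⊤
AllGreenSteps Q (k ∷ ks) = Green Q k × AllGreenSteps (mutate k Q) ks

IsMaximalGreenSequence : {n : ℕ} → Quiver (Fin n) → List (Fin n) → Set
IsMaximalGreenSequence {n} Q ks =
  AllGreenSteps (frame Q) ks × ((i : Fin n) → Red (mutateSeq ks (frame Q)) i)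

Qabc : ℕ → ℕ → ℕ → Quiver (Fin 3)
Qabc a b c zero          (suc zero)       = a
Qabc a b c (suc zero)    (suc (suc zero)) = b
Qabc a b c (suc (suc zero)) zero          = c
Qabc a b c _ _ = 0

{-# OPTIONS --safe #-}

-- By rotating the triangle assume a = 1, and number the vertices 0, 1, 2.  If b ≤ c then
-- (1, 2, 0, 1) is a maximal green sequence, if c ≤ b then (1, 0, 2, 1) is.  Since a = 1, the first
-- mutation adds exactly b arrows 0 → 2, which cancel against the c arrows 2 → 0; this makes the
-- quiver acyclic, and the same four mutations work whatever c ∸ b or b ∸ c is.
module Submission where

open import Defs
open import Data.Nat using (ℕ; _≥_; _+_; _*_; _∸_; _≟_)
open import Data.Nat.Properties
  using (≤-total; m+[n∸m]≡n; m+n∸n≡m; m+n∸m≡n; m≤n⇒m∸n≡0; 0∸n≡0; m≤m+n; m≤n+m;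
         +-identityʳ; +-comm)
open import Data.Sum using (_⊎_; inj₁; inj₂) renaming (map to map⊎)
open import Data.Product using (∃; _×_; _,_)
open import Data.List using (List; []; _∷_; map)
open import Data.List.Properties using (map-id)
open import Data.Fin using (Fin)
open import Data.Fin.Patterns using (0F; 1F; 2F)
open import Data.Fin.Properties using (all?) renaming (_≟_ to _≟F_)
open import Data.Fin.Permutation as Perm
  using (Permutation′; permutation; _⟨$⟩ʳ_; _⟨$⟩ˡ_; inverseʳ; inverseˡ)
open import Data.Vec using (Vec; []; _∷_; lookup; tabulate)
open import Data.Vec.Properties using (lookup∘tabulate)
open import Data.Unit using (tt)
open import Relation.Nullary using (yes; no; contradiction)
open import Relation.Nullary.Decidable using (True; toWitness)
open import Relation.Binary.PropositionalEquality
  using (_≡_; refl; sym; trans; cong; cong₂; subst; subst₂)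

-- The initial quiver is arbitrary, because induction along the sequence meets quivers that are no
-- longer framed. At `frame Q` this unfolds to `IsMaximalGreenSequence Q`.
IsMaximalGreenFrom : {n : ℕ} → Quiver (FVert n) → List (Fin n) → Set
IsMaximalGreenFrom Q ks = AllGreenSteps Q ks × (∀ i → Red (mutateSeq ks Q) i)

netArrows : {n : ℕ} → Fin n → Quiver (FVert n) → Quiver (FVert n)
netArrows k Q u v = (Q u v + Q u (inj₁ k) * Q (inj₁ k) v) ∸ (Q v u + Q v (inj₁ k) * Q (inj₁ k) u)

-- Invariance under relabelling of the vertices.

module _ {n : ℕ} (σ : Permutation′ n) where

  -- Frozen vertices move along with their partners, so the framing arrows `i → i'` are respected.
  relabel : FVert n → FVert n
  relabel = map⊎ (σ ⟨$⟩ʳ_) (σ ⟨$⟩ʳ_)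

  Relabels : Quiver (FVert n) → Quiver (FVert n) → Set
  Relabels Q Q′ = ∀ u v → Q′ (relabel u) (relabel v) ≡ Q u v

  σ-injective : ∀ {i j} → σ ⟨$⟩ʳ i ≡ σ ⟨$⟩ʳ j → i ≡ j
  σ-injective eq = trans (sym (inverseˡ σ)) (trans (cong (σ ⟨$⟩ˡ_) eq) (inverseˡ σ))

  -- Mutation uses only arrow counts and equality tests against `k`. As `σ` is injective, the tests
  -- before and after relabelling agree, and the mixed cases are contradictory.
  mutate-relabels : ∀ {Q Q′} k → Relabels Q Q′ → Relabels (mutate k Q) (mutate (σ ⟨$⟩ʳ k) Q′)
  mutate-relabels {Q} {Q′} k r = go
    where
    other : ∀ u v → netArrows (σ ⟨$⟩ʳ k) Q′ (relabel u) (relabel v) ≡ netArrows k Q u v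
    other u v = cong₂ _∸_
      (cong₂ _+_ (r u v) (cong₂ _*_ (r u (inj₁ k)) (r (inj₁ k) v)))
      (cong₂ _+_ (r v u) (cong₂ _*_ (r v (inj₁ k)) (r (inj₁ k) u)))

    go : Relabels (mutate k Q) (mutate (σ ⟨$⟩ʳ k) Q′)
    go (inj₂ _) (inj₂ _) = refl
    go (inj₁ i) v with i ≟F k | (σ ⟨$⟩ʳ i) ≟F (σ ⟨$⟩ʳ k)
    ... | yes _    | yes _  = r v (inj₁ i)
    ... | yes refl | no ne  = contradiction refl ne
    ... | no ne    | yes eq = contradiction (σ-injective eq) ne
    go (inj₁ i) (inj₂ j) | no _ | no _ = other (inj₁ i) (inj₂ j)
    go (inj₁ i) (inj₁ j) | no _ | no _ with j ≟F k | (σ ⟨$⟩ʳ j) ≟F (σ ⟨$⟩ʳ k)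
    ... | yes _    | yes _  = r (inj₁ j) (inj₁ i)
    ... | yes refl | no ne  = contradiction refl ne
    ... | no ne    | yes eq = contradiction (σ-injective eq) ne
    ... | no _     | no _   = other (inj₁ i) (inj₁ j)
    go (inj₂ i) (inj₁ j) with j ≟F k | (σ ⟨$⟩ʳ j) ≟F (σ ⟨$⟩ʳ k)
    ... | yes _    | yes _  = r (inj₁ j) (inj₂ i)
    ... | yes refl | no ne  = contradiction refl ne
    ... | no ne    | yes eq = contradiction (σ-injective eq) ne
    ... | no _     | no _   = other (inj₂ i) (inj₁ j)

  frame-relabels : ∀ {Q Q′} → (∀ i j → Q′ (σ ⟨$⟩ʳ i) (σ ⟨$⟩ʳ j) ≡ Q i j) →
    Relabels (frame Q) (frame Q′)
  frame-relabels r (inj₁ i) (inj₁ j) = r i j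
  frame-relabels r (inj₁ i) (inj₂ j) with i ≟F j | (σ ⟨$⟩ʳ i) ≟F (σ ⟨$⟩ʳ j)
  ... | yes _    | yes _  = refl
  ... | yes refl | no ne  = contradiction refl ne
  ... | no ne    | yes eq = contradiction (σ-injective eq) ne
  ... | no _     | no _   = refl
  frame-relabels r (inj₂ _) _ = refl

  green-relabels : ∀ {Q Q′ k} → Relabels Q Q′ → Green Q k → Green Q′ (σ ⟨$⟩ʳ k)
  green-relabels {Q′ = Q′} {k} r g j =
    subst (λ j → Q′ (inj₂ j) (inj₁ (σ ⟨$⟩ʳ k)) ≡ 0) (inverseʳ σ)
      (trans (r (inj₂ (σ ⟨$⟩ˡ j)) (inj₁ k)) (g (σ ⟨$⟩ˡ j)))

  red-relabels : ∀ {Q Q′} → Relabels Q Q′ → (∀ i → Red Q i) → ∀ i → Red Q′ i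
  red-relabels {Q′ = Q′} r red i j =
    subst₂ (λ i j → Q′ (inj₁ i) (inj₂ j) ≡ 0) (inverseʳ σ) (inverseʳ σ)
      (trans (r (inj₁ (σ ⟨$⟩ˡ i)) (inj₂ (σ ⟨$⟩ˡ j))) (red (σ ⟨$⟩ˡ i) (σ ⟨$⟩ˡ j)))

  maximalGreen-relabels : ∀ {Q Q′} ks → Relabels Q Q′ →
    IsMaximalGreenFrom Q ks → IsMaximalGreenFrom Q′ (map (σ ⟨$⟩ʳ_) ks)
  maximalGreen-relabels {Q} {Q′} [] r (_ , red) = tt , red-relabels {Q} {Q′} r red
  maximalGreen-relabels {Q} {Q′} (k ∷ ks) r ((g , gs) , red)
    with gs′ , red′ ← maximalGreen-relabels ks (mutate-relabels k r) (gs , red)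
    = (green-relabels {Q} {Q′} r g , gs′) , red′

-- Pointwise agreement of quivers is relabelling by the identity permutation.
maximalGreen-cong : ∀ {n} {Q Q′ : Quiver (FVert n)} ks → (∀ u v → Q′ u v ≡ Q u v) →
  IsMaximalGreenFrom Q ks → IsMaximalGreenFrom Q′ ks
maximalGreen-cong {Q = Q} {Q′} ks eq h =
  subst (IsMaximalGreenFrom Q′) (map-id ks) (maximalGreen-relabels Perm.id ks r h)
  where
  r : Relabels Perm.id Q Q′
  -- `relabel` reduces only on constructors, hence the case split.
  r (inj₁ i) (inj₁ j) = eq (inj₁ i) (inj₁ j)
  r (inj₁ i) (inj₂ j) = eq (inj₁ i) (inj₂ j)
  r (inj₂ i) (inj₁ j) = eq (inj₂ i) (inj₁ j)
  r (inj₂ i) (inj₂ j) = eq (inj₂ i) (inj₂ j)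

-- Quivers as explicit matrices.

Matrix : ℕ → Set
Matrix n = Vec (Vec ℕ n) n

-- m = non-frozen, f = frozen; mf counts the arrows non-frozen → frozen.
record Blocks (n : ℕ) : Set where
  constructor blocks
  field mm mf fm : Matrix n

⟦_⟧ : ∀ {n} → Blocks n → Quiver (FVert n)
⟦ blocks mm mf fm ⟧ (inj₁ i) (inj₁ j) = lookup (lookup mm i) j
⟦ blocks mm mf fm ⟧ (inj₁ i) (inj₂ j) = lookup (lookup mf i) j
⟦ blocks mm mf fm ⟧ (inj₂ i) (inj₁ j) = lookup (lookup fm i) j
⟦ blocks mm mf fm ⟧ (inj₂ _) (inj₂ _) = 0

matrix : ∀ {n} → (Fin n → Fin n → ℕ) → Matrix n
matrix f = tabulate λ i → tabulate (f i)

lookup-matrix : ∀ {n} (f : Fin n → Fin n → ℕ) i j → f i j ≡ lookup (lookup (matrix f) i) j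
lookup-matrix f i j = sym
  (trans (cong (λ v → lookup v j) (lookup∘tabulate (λ i → tabulate (f i)) i))
         (lookup∘tabulate (f i) j))

-- With vectors, agreement of two quivers is one equation between explicit matrices, which
-- evaluation and rewriting can settle.
toBlocks : ∀ {n} → Quiver (FVert n) → Blocks n
toBlocks Q = blocks (matrix λ i j → Q (inj₁ i) (inj₁ j))
                    (matrix λ i j → Q (inj₁ i) (inj₂ j))
                    (matrix λ i j → Q (inj₂ i) (inj₁ j))

⟦toBlocks⟧ : ∀ {n} (Q : Quiver (FVert n)) → (∀ i j → Q (inj₂ i) (inj₂ j) ≡ 0) →
  ∀ u v → Q u v ≡ ⟦ toBlocks Q ⟧ u v
⟦toBlocks⟧ Q z (inj₁ i) (inj₁ j) = lookup-matrix (λ i j → Q (inj₁ i) (inj₁ j)) i j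
⟦toBlocks⟧ Q z (inj₁ i) (inj₂ j) = lookup-matrix (λ i j → Q (inj₁ i) (inj₂ j)) i j
⟦toBlocks⟧ Q z (inj₂ i) (inj₁ j) = lookup-matrix (λ i j → Q (inj₂ i) (inj₁ j)) i j
⟦toBlocks⟧ Q z (inj₂ i) (inj₂ j) = z i j

infix 4 _─[_]→_
_─[_]→_ : ∀ {n} → Blocks n → Fin n → Blocks n → Set
S ─[ k ]→ T = toBlocks (mutate k ⟦ S ⟧) ≡ T

-- In the uses below parameters occur only in the block `mm`, so greenness concerns numerals and the
-- implicit test is decided by evaluation.
step : ∀ {n} {S T : Blocks n} {k ks} → S ─[ k ]→ T →
  {True (all? λ j → ⟦ S ⟧ (inj₂ j) (inj₁ k) ≟ 0)} →
  IsMaximalGreenFrom ⟦ T ⟧ ks → IsMaximalGreenFrom ⟦ S ⟧ (k ∷ ks)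
step {S = S} {k = k} {ks} refl {g} h
  with gs , red ← maximalGreen-cong ks (⟦toBlocks⟧ (mutate k ⟦ S ⟧) λ _ _ → refl) h
  = (toWitness g , gs) , red

done : ∀ {n} (S : Blocks n) →
  {True (all? λ i → all? λ j → ⟦ S ⟧ (inj₁ i) (inj₂ j) ≟ 0)} → IsMaximalGreenFrom ⟦ S ⟧ []
done S {g} = tt , toWitness g

[_,_,_] : ∀ {A : Set} → A → A → A → Vec A 3
[ x , y , z ] = x ∷ y ∷ z ∷ []

-- Vertex 1 occurs twice: it turns red at once, but the mutation at 0 cancels `1' → 1` against the
-- path `1 → 0 → 1'` and creates `1 → 0'`, so that 1 is green again.
maximalGreen-b≤c : ∀ b d → IsMaximalGreenSequence (Qabc 1 b (b + d)) (1F ∷ 2F ∷ 0F ∷ 1F ∷ [])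
maximalGreen-b≤c b d = maximalGreen-cong _ (⟦toBlocks⟧ (frame (Qabc 1 b (b + d))) λ _ _ → refl)
  (step {T = S₁} s₁ (step {T = S₂} s₂ (step {T = S₃} s₃ (step {T = S₄} s₄ (done S₄)))))
  where
  S₀ S₁ S₂ S₃ S₄ : Blocks 3
  S₀ = toBlocks (frame (Qabc 1 b (b + d)))
  S₁ = blocks [ [ 0 , 0 , 0 ] , [ 1 , 0 , 0 ] , [ d , b , 0 ] ]
              [ [ 1 , 1 , 0 ] , [ 0 , 0 , 0 ] , [ 0 , 0 , 1 ] ]
              [ [ 0 , 0 , 0 ] , [ 0 , 1 , 0 ] , [ 0 , 0 , 0 ] ]
  S₂ = blocks [ [ 0 , 0 , d ] , [ 1 , 0 , b ] , [ 0 , 0 , 0 ] ]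
              [ [ 1 , 1 , 0 ] , [ 0 , 0 , 0 ] , [ 0 , 0 , 0 ] ]
              [ [ 0 , 0 , 0 ] , [ 0 , 1 , 0 ] , [ 0 , 0 , 1 ] ]
  S₃ = blocks [ [ 0 , 1 , 0 ] , [ 0 , 0 , b + d ] , [ d , 0 , 0 ] ]
              [ [ 0 , 0 , 0 ] , [ 1 , 0 , 0 ] , [ 0 , 0 , 0 ] ]
              [ [ 1 , 0 , 0 ] , [ 1 , 0 , 0 ] , [ 0 , 0 , 1 ] ]
  S₄ = blocks [ [ 0 , 0 , b ] , [ 1 , 0 , 0 ] , [ 0 , b + d , 0 ] ]
              [ [ 0 , 0 , 0 ] , [ 0 , 0 , 0 ] , [ 0 , 0 , 0 ] ]
              [ [ 0 , 1 , 0 ] , [ 1 , 0 , 0 ] , [ 0 , 0 , 1 ] ]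

  s₁ : S₀ ─[ 1F ]→ S₁
  -- Between 0 and 2 the truncated differences are `b ∸ (b + d)`, which is 0, and `(b + d) ∸ b`,
  -- which is `d`.
  s₁ rewrite +-identityʳ (b + d) | +-identityʳ b | m≤n⇒m∸n≡0 (m≤m+n b d) | m+n∸m≡n b d = refl

  s₂ : S₁ ─[ 2F ]→ S₂
  -- Vertex 2 is a source among the non-frozen vertices, so no path runs through it and its arrows
  -- are merely reversed.
  s₂ = refl

  s₃ : S₂ ─[ 0F ]→ S₃
  s₃ rewrite +-identityʳ d | 0∸n≡0 (b + d) = refl

  s₄ : S₃ ─[ 1F ]→ S₄
  s₄ rewrite +-identityʳ (b + d) | +-identityʳ d | m+n∸n≡m b d | m≤n⇒m∸n≡0 (m≤n+m d b) = refl

-- After the first mutation `d` arrows `0 → 2` remain. Mutating at 0 next adds `d` arrows `1 → 2`,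
-- which reduce the `c + d` arrows `2 → 1` to `c` and leave 2 a source. The same mutation makes 1
-- green again.
maximalGreen-c≤b : ∀ c d → IsMaximalGreenSequence (Qabc 1 (c + d) c) (1F ∷ 0F ∷ 2F ∷ 1F ∷ [])
maximalGreen-c≤b c d = maximalGreen-cong _ (⟦toBlocks⟧ (frame (Qabc 1 (c + d) c)) λ _ _ → refl)
  (step {T = S₁} s₁ (step {T = S₂} s₂ (step {T = S₃} s₃ (step {T = S₄} s₄ (done S₄)))))
  where
  S₀ S₁ S₂ S₃ S₄ : Blocks 3
  S₀ = toBlocks (frame (Qabc 1 (c + d) c))
  S₁ = blocks [ [ 0 , 0 , d ] , [ 1 , 0 , 0 ] , [ 0 , c + d , 0 ] ]
              [ [ 1 , 1 , 0 ] , [ 0 , 0 , 0 ] , [ 0 , 0 , 1 ] ]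
              [ [ 0 , 0 , 0 ] , [ 0 , 1 , 0 ] , [ 0 , 0 , 0 ] ]
  S₂ = blocks [ [ 0 , 1 , 0 ] , [ 0 , 0 , 0 ] , [ d , c , 0 ] ]
              [ [ 0 , 0 , 0 ] , [ 1 , 0 , 0 ] , [ 0 , 0 , 1 ] ]
              [ [ 1 , 0 , 0 ] , [ 1 , 0 , 0 ] , [ 0 , 0 , 0 ] ]
  S₃ = blocks [ [ 0 , 1 , d ] , [ 0 , 0 , c ] , [ 0 , 0 , 0 ] ]
              [ [ 0 , 0 , 0 ] , [ 1 , 0 , 0 ] , [ 0 , 0 , 0 ] ]
              [ [ 1 , 0 , 0 ] , [ 1 , 0 , 0 ] , [ 0 , 0 , 1 ] ]
  S₄ = blocks [ [ 0 , 0 , c + d ] , [ 1 , 0 , 0 ] , [ 0 , c , 0 ] ]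
              [ [ 0 , 0 , 0 ] , [ 0 , 0 , 0 ] , [ 0 , 0 , 0 ] ]
              [ [ 0 , 1 , 0 ] , [ 1 , 0 , 0 ] , [ 0 , 0 , 1 ] ]

  s₁ : S₀ ─[ 1F ]→ S₁
  s₁ rewrite +-identityʳ (c + d) | +-identityʳ c | m≤n⇒m∸n≡0 (m≤m+n c d) | m+n∸m≡n c d = refl

  s₂ : S₁ ─[ 0F ]→ S₂
  s₂ rewrite +-identityʳ (c + d) | +-identityʳ d | m+n∸n≡m c d | m≤n⇒m∸n≡0 (m≤n+m d c) = refl

  s₃ : S₂ ─[ 2F ]→ S₃
  s₃ = refl

  s₄ : S₃ ─[ 1F ]→ S₄
  s₄ rewrite +-identityʳ c | +-comm d c | 0∸n≡0 (c + d) = refl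

HasMaximalGreenSequence : ∀ {n} → Quiver (Fin n) → Set
HasMaximalGreenSequence {n} Q = ∃ λ (ks : List (Fin n)) → IsMaximalGreenSequence Q ks

hasMaximalGreen-1bc : ∀ b c → HasMaximalGreenSequence (Qabc 1 b c)
hasMaximalGreen-1bc b c with ≤-total b c
... | inj₁ b≤c = subst (λ c → HasMaximalGreenSequence (Qabc 1 b c))
                   (m+[n∸m]≡n b≤c) (_ , maximalGreen-b≤c b (c ∸ b))
... | inj₂ c≤b = subst (λ b → HasMaximalGreenSequence (Qabc 1 b c))
                   (m+[n∸m]≡n c≤b) (_ , maximalGreen-c≤b c (b ∸ c))

rotation : Permutation′ 3
rotation = permutation (lookup [ 1F , 2F , 0F ]) (lookup [ 2F , 0F , 1F ])
  (λ { 0F → refl ; 1F → refl ; 2F → refl }) (λ { 0F → refl ; 1F → refl ; 2F → refl })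

-- Under `rotation` the `b` arrows `0 → 1` of `Qabc b c a` become the arrows `1 → 2` of
-- `Qabc a b c`, and likewise around the triangle.
hasMaximalGreen-rotate : ∀ a b c →
  HasMaximalGreenSequence (Qabc b c a) → HasMaximalGreenSequence (Qabc a b c)
hasMaximalGreen-rotate a b c (ks , h) =
  _ , maximalGreen-relabels rotation ks (frame-relabels rotation r) h
  where
  r : ∀ i j → Qabc a b c (rotation ⟨$⟩ʳ i) (rotation ⟨$⟩ʳ j) ≡ Qabc b c a i j
  r 0F 0F = refl
  r 0F 1F = refl
  r 0F 2F = refl
  r 1F 0F = refl
  r 1F 1F = refl
  r 1F 2F = refl
  r 2F 0F = refl
  r 2F 1F = refl
  r 2F 2F = refl

theorem5p2 : (a b c : ℕ) → a ≥ 1 → b ≥ 1 → c ≥ 1 →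
    (a ≡ 1 ⊎ b ≡ 1 ⊎ c ≡ 1) →
    ∃ λ (ks : List (Fin 3)) → IsMaximalGreenSequence (Qabc a b c) ks
theorem5p2 _ b c _ _ _ (inj₁ refl) = hasMaximalGreen-1bc b c
-- Each rotation moves the second weight to the front: one brings `b` there, two bring `c`.
theorem5p2 a _ c _ _ _ (inj₂ (inj₁ refl)) = hasMaximalGreen-rotate a 1 c (hasMaximalGreen-1bc c a)
theorem5p2 a b _ _ _ _ (inj₂ (inj₂ refl)) =
  hasMaximalGreen-rotate a b 1 (hasMaximalGreen-rotate b 1 a (hasMaximalGreen-1bc a b))
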